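{- For every sufficiently large positive integer $n$, there exists a string $X$ of length $n$ such that $z(X^R)/z(X) \in \Omega(\log n)$. That is, there exist constants $\kappa>0$ and $n_0$ such that for every integer $n\ge n_0$ there is a string $X$ with $|X|=n$ and $z(X^R)\ge \kappa \log n\cdot z(X)$.
   Context: The alphabet is not fixed: the string may be over an alphabet depending on $n$. Strings are indexed from $0$: a string $S$ of length $n=|S|$ is $S[0]\cdots S[n-1]$, $S[i..j]$ is the substring from position $i$ to position $j$, and $S^R=S[n-1]\cdots S[0]$ is the reversal. A factorization of $S$ is a sequence of nonempty strings (phrases) $F_1,\dots,F_m$ with $S=F_1\cdots F_m$; the starting position of $F_i$ is $b_i=\sum_{k=1}^{i-1}|F_k|$. The Lempel--Ziv (LZ) factorization of $S$ is built from left to right: if the character $S[b_i]$ has no occurrence in $S$ starting before $b_i$, then $F_i=S[b_i]$; otherwise $F_i$ is the longest prefix of $S[b_i..n-1]$ that has an occurrence in $S$ starting before $b_i$ (this earlier occurrence may overlap $F_i$). The number of phrases is denoted $z(S)$. -}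

module Defs where

open import Data.Fin.Base using (Fin)
import Data.Fin.Properties as Fin
open import Data.List.Base using (List; []; _∷_; [_]; _++_; length; drop; take; concat)
open import Data.List.Properties
  using (drop-drop; drop-all; length-take)
open import Data.List.Relation.Binary.Prefix.Heterogeneous using (Prefix; []; _∷_)
open import Data.List.Relation.Binary.Prefix.Heterogeneous.Properties
  using (length-mono; prefix?)
open import Data.Nat.Base using (ℕ; zero; suc; _+_; _≤_; _<_; z≤n; s≤s)
open import Data.Nat.Properties
  using (≤-refl; ≤-reflexive; ≤-trans; ≤-antisym; n≤1+n; m≤n⇒m<n∨m≡n; +-comm; +-suc;
         +-identityʳ; +-monoˡ-≤; +-monoʳ-≤; suc-injective; m≤n⇒m⊓n≡m; anyUpTo?)
open import Data.Product.Base using (∃; _×_; _,_; proj₁; proj₂)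
open import Data.Sum.Base using (inj₁; inj₂)
open import Level using (Level)
open import Relation.Binary.Definitions using (DecidableEquality)
open import Relation.Binary.PropositionalEquality
  using (_≡_; refl; sym; trans; cong; subst)
open import Relation.Nullary.Decidable using (Dec; yes; no)
open import Relation.Nullary.Negation using (¬_; contradiction)

private
  variable
    a : Level

module LempelZiv {A : Set a} where

  String : Set a
  String = List A

  private
    variable
      S F G T : String
      b : ℕ
      c : A
      Fs Gs : List String

  infix 4 _≼_

  _≼_ : String → String → Set a
  _≼_ = Prefix _≡_

  -- The occurrence may run past position b: only its start is constrained.
  OccursBefore : String → ℕ → String → Set a
  OccursBefore S b F = ∃ λ p → p < b × F ≼ drop p S

  record LongestEarlier (S : String) (b : ℕ) (F : String) : Set a where
    field
      isPrefix : F ≼ drop b S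
      occurs   : OccursBefore S b F
      longest  : ∀ {G} → G ≼ drop b S → OccursBefore S b G → length G ≤ length F

  -- In both cases the hypothesis drop b S ≡ c ∷ T says that c is S[b].
  data Phrase (S : String) (b : ℕ) : String → Set a where
    fresh : drop b S ≡ c ∷ T → ¬ OccursBefore S b [ c ] → Phrase S b [ c ]
    copy  : drop b S ≡ c ∷ T → OccursBefore S b [ c ] →
            LongestEarlier S b F → Phrase S b F

  -- The index is the starting position of the first remaining phrase.
  data LZFrom (S : String) : ℕ → List String → Set a where
    done : b ≡ length S → LZFrom S b []
    step : Phrase S b F → LZFrom S (b + length F) Fs → LZFrom S b (F ∷ Fs)

  IsLZ : String → List String → Set a
  IsLZ S = LZFrom S 0

  phrase-nonempty : Phrase S b F → 1 ≤ length F
  phrase-nonempty (fresh _ _)      = s≤s z≤n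
  phrase-nonempty (copy e o l) =
    LongestEarlier.longest l (subst ([ _ ] ≼_) (sym e) (refl ∷ [])) o

  phrase-prefix : Phrase S b F → F ≼ drop b S
  phrase-prefix (fresh e _)  = subst ([ _ ] ≼_) (sym e) (refl ∷ [])
  phrase-prefix (copy _ _ l) = LongestEarlier.isPrefix l

  private
    ≼-split : F ≼ T → F ++ drop (length F) T ≡ T
    ≼-split []         = refl
    ≼-split (refl ∷ p) = cong (_ ∷_) (≼-split p)

    ≼-unique : F ≼ T → G ≼ T → length F ≡ length G → F ≡ G
    ≼-unique []         []         _ = refl
    ≼-unique (refl ∷ p) (refl ∷ q) e = cong (_ ∷_) (≼-unique p q (suc-injective e))

  LZFrom-concat : LZFrom S b Fs → concat Fs ≡ drop b S
  LZFrom-concat {S} {b} (done e) = sym (drop-all b S (≤-reflexive (sym e)))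
  LZFrom-concat {S} {b} (step {F = F} φ r) =
    trans (cong (F ++_) (trans (LZFrom-concat r) (sym (drop-drop b (length F) S))))
          (≼-split (phrase-prefix φ))

  IsLZ-concat : IsLZ S Fs → concat Fs ≡ S
  IsLZ-concat = LZFrom-concat

  private
    ∷-head : ∀ {c d : A} {T U : String} → c ∷ T ≡ d ∷ U → c ≡ d
    ∷-head refl = refl

    phrase-inside : Phrase S b F → ¬ (b ≡ length S)
    phrase-inside {S} {b} φ e
      with ≤-trans (phrase-nonempty φ) (length-mono (phrase-prefix φ))
    ... | 1≤d rewrite drop-all b S (≤-reflexive (sym e)) with () ← 1≤d

  phrase-unique : Phrase S b F → Phrase S b G → F ≡ G
  phrase-unique (fresh e _) (fresh e′ _) = cong [_] (∷-head (trans (sym e) e′))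
  phrase-unique {S} {b} (fresh e ¬o) (copy e′ o _) =
    contradiction (subst (λ d → OccursBefore S b [ d ]) (∷-head (trans (sym e′) e)) o) ¬o
  phrase-unique {S} {b} (copy e o _) (fresh e′ ¬o) =
    contradiction (subst (λ d → OccursBefore S b [ d ]) (∷-head (trans (sym e) e′)) o) ¬o
  phrase-unique (copy _ _ l) (copy _ _ m) =
    ≼-unique L.isPrefix M.isPrefix
      (≤-antisym (M.longest L.isPrefix L.occurs) (L.longest M.isPrefix M.occurs))
    where
    module L = LongestEarlier l
    module M = LongestEarlier m

  LZFrom-unique : LZFrom S b Fs → LZFrom S b Gs → Fs ≡ Gs
  LZFrom-unique (done _)   (done _)   = refl
  LZFrom-unique (done e)   (step φ _) = contradiction e (phrase-inside φ)
  LZFrom-unique (step φ _) (done e)   = contradiction e (phrase-inside φ)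
  LZFrom-unique (step φ r) (step ψ s) with refl ← phrase-unique φ ψ =
    cong (_ ∷_) (LZFrom-unique r s)

  module _ (_≟_ : DecidableEquality A) where

    occursBefore? : ∀ S b F → Dec (OccursBefore S b F)
    occursBefore? S b F = anyUpTo? (λ p → prefix? _≟_ F (drop p S)) b

    private
      take-≼ : ∀ n (T : String) → take n T ≼ T
      take-≼ zero    T       = []
      take-≼ (suc n) []      = []
      take-≼ (suc n) (c ∷ T) = refl ∷ take-≼ n T

      ≼-take : F ≼ T → F ≡ take (length F) T
      ≼-take []         = refl
      ≼-take (refl ∷ p) = cong (_ ∷_) (≼-take p)

      Bounded : String → ℕ → ℕ → String → Set a
      Bounded S b n F = F ≼ drop b S × OccursBefore S b F ×
        (∀ {G} → length G ≤ n → G ≼ drop b S → OccursBefore S b G → length G ≤ length F)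

      search : ∀ S b n → OccursBefore S b [] → n ≤ length (drop b S) → ∃ (Bounded S b n)
      search S b zero    o _  = [] , [] , o , λ G≤0 _ _ → G≤0
      search S b (suc n) o n< with occursBefore? S b (take (suc n) (drop b S))
      ... | yes q = take (suc n) (drop b S) , take-≼ (suc n) _ , q ,
                    λ G≤n _ _ → ≤-trans G≤n (≤-reflexive (sym
                      (trans (length-take (suc n) (drop b S)) (m≤n⇒m⊓n≡m n<))))
      ... | no ¬q with search S b n o (≤-trans (n≤1+n n) n<)
      ...   | F , F≼ , Fo , max = F , F≼ , Fo , max′
        where
        max′ : ∀ {G} → length G ≤ suc n → G ≼ drop b S → OccursBefore S b G →
               length G ≤ length F
        max′ G≤ G≼ Go with m≤n⇒m<n∨m≡n G≤
        ... | inj₁ (s≤s G≤n) = max G≤n G≼ Go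
        ... | inj₂ e = contradiction
          (subst (OccursBefore S b)
                 (trans (≼-take G≼) (cong (λ k → take k (drop b S)) e)) Go) ¬q

    longestEarlier : ∀ S b → OccursBefore S b [] → ∃ (LongestEarlier S b)
    longestEarlier S b o with search S b (length (drop b S)) o ≤-refl
    ... | F , F≼ , Fo , max = F , record
      { isPrefix = F≼
      ; occurs   = Fo
      ; longest  = λ G≼ → max (length-mono G≼) G≼
      }

    phrase : ∀ S b {c T} → drop b S ≡ c ∷ T → ∃ (Phrase S b)
    phrase S b {c} e with occursBefore? S b [ c ]
    ... | no ¬o = [ c ] , fresh e ¬o
    ... | yes o@(p , p<b , _) with longestEarlier S b (p , p<b , [])
    ...   | F , l = F , copy e o l

    private
      ≼-fits : b ≤ length S → F ≼ drop b S → b + length F ≤ length S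
      ≼-fits {zero}              _       p = length-mono p
      ≼-fits {suc b} {S = x ∷ S} (s≤s h) p = s≤s (≼-fits h p)

      drop≡[] : ∀ b (S : String) → b ≤ length S → drop b S ≡ [] → b ≡ length S
      drop≡[] zero    []      _       _ = refl
      drop≡[] (suc b) (_ ∷ S) (s≤s h) e = cong suc (drop≡[] b S h e)

      build : ∀ k S b → b ≤ length S → length S ≤ b + k → ∃ (LZFrom S b)
      build zero S b b≤ ≤b =
        [] , done (≤-antisym b≤ (≤-trans ≤b (≤-reflexive (+-identityʳ b))))
      build (suc k) S b b≤ ≤b with drop b S in e
      ... | []    = [] , done (drop≡[] b S b≤ e)
      ... | _ ∷ _ with phrase S b e
      ...   | F , φ with build k S (b + length F) (≼-fits b≤ (phrase-prefix φ)) fuel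
        where
        fuel : length S ≤ b + length F + k
        fuel = ≤-trans ≤b (≤-trans (≤-reflexive (trans (+-suc b k) (cong (_+ k) (+-comm 1 b))))
                 (+-monoˡ-≤ k (+-monoʳ-≤ b (phrase-nonempty φ))))
      ...     | Fs , r = F ∷ Fs , step φ r

    lz : ∀ S → ∃ (IsLZ S)
    lz S = build (length S) S 0 z≤n ≤-refl

open LempelZiv public using (IsLZ; lz)

z : ∀ {σ} → List (Fin σ) → ℕ
z S = length (proj₁ (lz Fin._≟_ S))

z-unique : ∀ {σ} {S : List (Fin σ)} {Fs} → IsLZ S Fs → z S ≡ length Fs
z-unique {S = S} r = cong length (LempelZiv.LZFrom-unique (proj₂ (lz Fin._≟_ S)) r)

{-# OPTIONS --safe #-}
module Submission where

open import Defs
open import Data.Empty using (⊥-elim)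
open import Data.Fin.Base as Fin using (Fin; combine)
open import Data.Fin.Properties as Fin using (combine-injective; toℕ-fromℕ<; toℕ-injective)
import Data.Integer.Base as ℤ
import Data.Integer.Properties as ℤ
open import Data.List.Base using (List; []; _∷_; length; drop; reverse; applyUpTo; applyDownFrom)
open import Data.List.Properties
  using (length-applyUpTo; length-applyDownFrom; length-drop; reverse-applyDownFrom)
open import Data.List.Relation.Binary.Prefix.Heterogeneous using ([]; _∷_)
open import Data.List.Relation.Binary.Prefix.Heterogeneous.Properties using (length-mono)
open import Data.Nat.Base using (ℕ; _≥_)
open import Data.Nat.Logarithm using (⌈log₂_⌉; ⌈log₂⌉-mono-≤; ⌈log₂2^n⌉≡n)
open import Data.Product.Base using (∃; ∃₂; ∃-syntax; _×_; _,_; proj₁; proj₂)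
import Data.Rational.Base as ℚ
import Data.Rational.Properties as ℚ
import Data.Rational.Unnormalised.Base as ℚᵘ
import Data.Rational.Unnormalised.Properties as ℚᵘ
open import Data.Sum.Base using (_⊎_; inj₁; inj₂; [_,_]′)
open import Function.Base using (_∘_)
open import Level using (Level)
open import Relation.Binary.PropositionalEquality
open import Relation.Nullary.Decidable using (yes; no)
open import Relation.Nullary.Negation using (¬_; contradiction)

-- Write Y as rows of m = 2 ^ k symbols, each tagged with its column. The row of
-- time t, 0 ≤ t ≤ m, records how t tokens are split as evenly as possible over the
-- m columns: rows of times at least 2 ^ d apart differ in each of the 2 ^ d aligned
-- windows of m / 2 ^ d columns, while rows of consecutive times differ in a single
-- column. Y lists the dyadic times from coarse to fine, 2 ^ j rows of level j, and
-- then all the times 0, 1, …, m. In a row of level j each of the 2 ^ (k - 1 - j)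
-- windows is new, so each level costs 2 ^ (k - 1) phrases, k 2 ^ (k - 1) in all.
-- Its reversal X starts with the times m, …, 1, 0, which cost three phrases each,
-- after which every dyadic row is a copy of an earlier row: O(m) phrases in all.

private
  variable
    a : Level
    A : Set a
    S : List A
    b e e′ n p s ℓ x x′ : ℕ

-- Repetitions and phrase counts of greedy parses.

module Greedy where

  open LempelZiv
    using (_≼_; LongestEarlier; Phrase; fresh; copy; LZFrom; done; step;
           phrase-nonempty; phrase-prefix)
  open import Data.Nat.Base
  open import Data.Nat.Properties

  drop-applyUpTo : ∀ (f : ℕ → A) b n → drop b (applyUpTo f n) ≡ applyUpTo (f ∘ (b +_)) (n ∸ b)
  drop-applyUpTo f zero    n       = refl
  drop-applyUpTo f (suc b) zero    = refl
  drop-applyUpTo f (suc b) (suc n) = drop-applyUpTo (f ∘ suc) b n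

  applyUpTo-≼ : ∀ {f g : ℕ → A} → ℓ ≤ n → (∀ {i} → i < ℓ → f i ≡ g i) →
                applyUpTo f ℓ ≼ applyUpTo g n
  applyUpTo-≼ z≤n       f≗g = []
  applyUpTo-≼ (s≤s ℓ≤n) f≗g = f≗g z<s ∷ applyUpTo-≼ ℓ≤n (f≗g ∘ s<s)

  ≼-applyUpTo : ∀ {F : List A} {f g : ℕ → A} {m n} → F ≼ applyUpTo f m → F ≼ applyUpTo g n →
                ∀ {i} → i < length F → f i ≡ g i
  ≼-applyUpTo {m = suc _} {n = suc _} (refl ∷ _) (eq ∷ _) {zero}  _         = eq
  ≼-applyUpTo {m = suc _} {n = suc _} (_ ∷ u)    (_ ∷ v)    {suc i} (s<s i<ℓ) = ≼-applyUpTo u v i<ℓ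

  applyDownFrom≡applyUpTo : ∀ (f : ℕ → A) n →
                            applyDownFrom f n ≡ applyUpTo (λ i → f (n ∸ suc i)) n
  applyDownFrom≡applyUpTo f zero    = refl
  applyDownFrom≡applyUpTo f (suc n) = cong (f n ∷_) (applyDownFrom≡applyUpTo f n)

  -- The stretches at `p` and `b` may overlap, as LZ sources may; a long periodic run thus costs a
  -- single phrase.
  Repeats : (ℕ → A) → ℕ → ℕ → ℕ → Set _
  Repeats f p b ℓ = ∀ {i} → i < ℓ → f (p + i) ≡ f (b + i)

  module _ {f : ℕ → A} where

    private
      ≼-drop : p + ℓ ≤ n → (∀ {i} → i < ℓ → f (b + i) ≡ f (p + i)) →
               applyUpTo (f ∘ (b +_)) ℓ ≼ drop p (applyUpTo f n)
      ≼-drop {p} {ℓ} {n} p+ℓ≤n eq rewrite drop-applyUpTo f p n =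
        applyUpTo-≼ (m+n≤o⇒m≤o∸n ℓ (subst (_≤ n) (+-comm p ℓ) p+ℓ≤n)) eq

    phrase-repeats : ∀ {F} → Phrase (applyUpTo f n) b F →
                     length F ≡ 1 ⊎ ∃₂ λ p (_ : p < b) → Repeats f p b (length F)
    phrase-repeats (fresh _ _) = inj₁ refl
    phrase-repeats {n} {b} (copy _ _ l) with p , p<b , F≼p ← LongestEarlier.occurs l =
      inj₂ (p , p<b , ≼-applyUpTo (subst (_ ≼_) (drop-applyUpTo f p n) F≼p)
                                  (subst (_ ≼_) (drop-applyUpTo f b n) (LongestEarlier.isPrefix l)))

    -- Greediness: the repetition is a candidate that `longest` must dominate. A `fresh` phrase
    -- admits no repetition of positive length, since its first symbol would then have an earlier
    -- occurrence.
    repeats-length : ∀ {F} → Phrase (applyUpTo f n) b F → p < b → b + ℓ ≤ n →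
                     Repeats f p b ℓ → ℓ ≤ length F
    repeats-length {n} {b} {p} {ℓ} {F} φ p<b b+ℓ≤n rep = go ℓ φ here there
      where
      here : applyUpTo (f ∘ (b +_)) ℓ ≼ drop b (applyUpTo f n)
      here = ≼-drop b+ℓ≤n (λ _ → refl)
      there : applyUpTo (f ∘ (b +_)) ℓ ≼ drop p (applyUpTo f n)
      there = ≼-drop (≤-trans (+-monoˡ-≤ ℓ (<⇒≤ p<b)) b+ℓ≤n) (sym ∘ rep)
      go : ∀ ℓ {h : ℕ → A} {F} → Phrase (applyUpTo f n) b F → applyUpTo h ℓ ≼ drop b (applyUpTo f n) →
           applyUpTo h ℓ ≼ drop p (applyUpTo f n) → ℓ ≤ length F
      go ℓ {h} (copy _ _ l) u v =
        subst (_≤ _) (length-applyUpTo h ℓ) (LongestEarlier.longest l u (p , p<b , v))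
      go zero    (fresh _ _)   _ _ = z≤n
      go (suc ℓ) (fresh eq ¬o) u v with drop b (applyUpTo f n) | drop p (applyUpTo f n) in eqp
      go (suc ℓ) (fresh refl ¬o) (refl ∷ _) (refl ∷ _) | _ ∷ _ | _ ∷ _ =
        contradiction (p , p<b , subst (_ ≼_) (sym eqp) (refl ∷ [])) ¬o

  LZFrom-end : ∀ {Fs} → LZFrom S b Fs → length S ≤ b → Fs ≡ []
  LZFrom-end (done _) _ = refl
  LZFrom-end {S = S} {b} (step φ _) S≤b with () ←
    ≤-trans (phrase-nonempty φ) (≤-trans (length-mono (phrase-prefix φ))
      (≤-reflexive (trans (length-drop b S) (m≤n⇒m∸n≡0 S≤b))))

  -- The greedy parse, once at or beyond b, reaches e within x phrases.
  AtMost : List A → ℕ → ℕ → ℕ → Set _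
  AtMost S b e x = ∀ {b₀ Fs} → b ≤ b₀ → LZFrom S b₀ Fs →
    ∃₂ λ e₀ Gs → e ≤ e₀ × LZFrom S e₀ Gs × length Fs ≤ x + length Gs

  -- The greedy parse, while still at or before b, uses up x phrases without passing e.
  AtLeast : List A → ℕ → ℕ → ℕ → Set _
  AtLeast S b e x = ∀ {b₀ Fs} → b₀ ≤ b → LZFrom S b₀ Fs →
    ∃₂ λ e₀ Gs → e₀ ≤ e × LZFrom S e₀ Gs × x + length Gs ≤ length Fs

  AtMost-refl : AtMost S b b 0
  AtMost-refl b≤ r = _ , _ , b≤ , r , ≤-refl

  AtMost-trans : AtMost S b e x → AtMost S e e′ x′ → AtMost S b e′ (x + x′)
  AtMost-trans {x = x} {x′ = x′} P Q b≤ r =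
    let _ , _ , e≤ , r₁ , le₁ = P b≤ r
        _ , _ , e′≤ , r₂ , le₂ = Q e≤ r₁
    in _ , _ , e′≤ , r₂ ,
    ≤-trans le₁ (≤-trans (+-monoʳ-≤ x le₂) (≤-reflexive (sym (+-assoc x x′ _))))

  AtLeast-refl : AtLeast S b b 0
  AtLeast-refl ≤b r = _ , _ , ≤b , r , ≤-refl

  AtLeast-trans : AtLeast S b e x → AtLeast S e e′ x′ → AtLeast S b e′ (x + x′)
  AtLeast-trans {x = x} {x′ = x′} P Q ≤b r =
    let _ , _ , ≤e , r₁ , le₁ = P ≤b r
        _ , _ , ≤e′ , r₂ , le₂ = Q ≤e r₁
    in _ , _ , ≤e′ , r₂ ,
    ≤-trans (≤-reflexive (+-assoc x x′ _)) (≤-trans (+-monoʳ-≤ x le₂) le₁)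

  AtLeast-iterate : ∀ {w} N → (∀ {i} → i < N → AtLeast S (b + i * w) (b + suc i * w) x) →
                    AtLeast S b (b + N * w) (N * x)
  AtLeast-iterate {b = b} zero    P rewrite +-identityʳ b = AtLeast-refl
  AtLeast-iterate {S = S} {b = b} {x = x} {w = w} (suc N) P =
    subst (AtLeast S b _) (+-comm (N * x) x)
      (AtLeast-trans (AtLeast-iterate N (P ∘ m<n⇒m<1+n)) (P (n<1+n N)))

  AtMost-end : ∀ {Fs} → AtMost S 0 (length S) x → IsLZ S Fs → length Fs ≤ x
  AtMost-end {x = x} P r with _ , _ , S≤ , r₁ , le ← P z≤n r =
    ≤-trans le (≤-reflexive
      (trans (cong (λ Gs → x + length Gs) (LZFrom-end r₁ S≤)) (+-identityʳ x)))

  AtLeast-end : ∀ {Fs} → AtLeast S 0 e x → IsLZ S Fs → x ≤ length Fs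
  AtLeast-end P r with _ , _ , _ , _ , le ← P z≤n r = m+n≤o⇒m≤o _ le

  module _ {f : ℕ → A} where

    AtMost-char : b < n → AtMost (applyUpTo f n) b (suc b) 1
    AtMost-char {b} {n} b<n {b₀} b≤ r with b <? b₀
    ... | yes b<b₀ = _ , _ , b<b₀ , r , n≤1+n _
    AtMost-char {b} {n} b<n {b₀} b≤ (done e) | no b≮b₀ =
      contradiction (subst (b <_) (sym (trans e (length-applyUpTo f n))) b<n) b≮b₀
    AtMost-char {b} {n} b<n {b₀} b≤ (step φ r) | no _ =
      _ , _ , ≤-trans (≤-reflexive (+-comm 1 b)) (+-mono-≤ b≤ (phrase-nonempty φ)) , r , ≤-refl

    -- A phrase starting `δ` symbols inside the stretch can still copy the rest of it from `p + δ`,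
    -- so the greedy choice reaches at least `b + ℓ`, wherever the earlier phrases happened to end.
    AtMost-copy : p < b → b + ℓ ≤ n → Repeats f p b ℓ → AtMost (applyUpTo f n) b (b + ℓ) 1
    AtMost-copy {p} {b} {ℓ} {n} p<b b+ℓ≤n rep {b₀} b≤ r with b + ℓ ≤? b₀
    ... | yes b+ℓ≤b₀ = _ , _ , b+ℓ≤b₀ , r , n≤1+n _
    AtMost-copy {n = n} p<b b+ℓ≤n rep {b₀} b≤ (done e) | no b₀<b+ℓ =
      contradiction (≤-trans b+ℓ≤n (≤-reflexive (sym (trans e (length-applyUpTo f n))))) b₀<b+ℓ
    AtMost-copy {p} {b} {ℓ} {n} p<b b+ℓ≤n rep {b₀} b≤ (step {F = F} φ r) | no b₀≱b+ℓ
      with δ , refl ← m≤n⇒∃[o]m+o≡n b≤ | ε , eq ← m≤n⇒∃[o]m+o≡n (≰⇒≥ b₀≱b+ℓ) =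
      _ , _ , subst (_≤ b + δ + length F) eq (+-monoʳ-≤ (b + δ) long) , r , ≤-refl
      where
      long : ε ≤ length F
      long = repeats-length φ (+-monoˡ-< δ p<b) (subst (_≤ n) (sym eq) b+ℓ≤n) λ {i} i<ε →
        trans (cong f (+-assoc p δ i))
          (trans (rep (+-cancelˡ-< b (δ + i) ℓ
                    (subst₂ _<_ (+-assoc b δ i) eq (+-monoʳ-< (b + δ) i<ε))))
                 (cong f (sym (+-assoc b δ i))))

    -- A phrase that starts at or before `s` and runs past `e` has an earlier source; the part of
    -- that source lying over the stretch from `s` to `e` would contradict novelty. So the first
    -- phrase to end beyond `s` ends by `e`.
    AtLeast-novel : s < e → e ≤ n → (∀ {p} → p < s → ¬ Repeats f p s (e ∸ s)) →
                    AtLeast (applyUpTo f n) s e 1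
    AtLeast-novel {s} {e} {n} s<e e≤n new {b₀} ≤s (done eq) =
      contradiction (subst (_≤ s) (trans eq (length-applyUpTo f n)) ≤s) (<⇒≱ (≤-trans s<e e≤n))
    AtLeast-novel {s} {e} {n} s<e e≤n new {b₀} ≤s (step {F = F} φ r) with b₀ + length F ≤? s
    ... | yes skip with _ , _ , ≤e , r₁ , le ← AtLeast-novel s<e e≤n new skip r =
      _ , _ , ≤e , r₁ , m≤n⇒m≤1+n le
    ... | no _ with b₀ + length F ≤? e
    ...   | yes ≤e = _ , _ , ≤e , r , ≤-refl
    ...   | no ≰e with phrase-repeats φ
    ...     | inj₁ eq = contradiction
      (≤-trans (≤-reflexive (trans (cong (b₀ +_) eq) (+-comm b₀ 1))) (≤-trans (s≤s ≤s) s<e)) ≰e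
    ...     | inj₂ (p , p<b₀ , rep) with δ , refl ← m≤n⇒∃[o]m+o≡n ≤s =
      ⊥-elim (new (+-monoˡ-< δ p<b₀) shifted)
      where
      shifted : Repeats f (p + δ) (b₀ + δ) (e ∸ (b₀ + δ))
      shifted {i} i< = trans (cong f (+-assoc p δ i)) (trans (rep inside) (cong f (sym (+-assoc b₀ δ i))))
        where
        inside : δ + i < length F
        inside = +-cancelˡ-< b₀ (δ + i) (length F) (begin-strict
          b₀ + (δ + i)       ≡⟨ +-assoc b₀ δ i ⟨
          b₀ + δ + i         <⟨ +-monoʳ-< (b₀ + δ) i< ⟩
          b₀ + δ + (e ∸ (b₀ + δ)) ≡⟨ m+[n∸m]≡n (<⇒≤ s<e) ⟩
          e                  <⟨ ≰⇒> ≰e ⟩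
          b₀ + length F ∎)
          where open ≤-Reasoning

  AtMost-mono : ∀ {S : List A} {b e x x′} → x ≤ x′ → AtMost S b e x → AtMost S b e x′
  AtMost-mono x≤x′ P b≤ r with _ , _ , e≤ , r₁ , le ← P b≤ r =
    _ , _ , e≤ , r₁ , ≤-trans le (+-monoˡ-≤ _ x≤x′)

  AtMost-chars : ∀ {f : ℕ → A} N → N ≤ n → AtMost (applyUpTo f n) 0 N N
  AtMost-chars zero _ = AtMost-refl
  AtMost-chars {f = f} (suc N) N<n = subst (AtMost _ 0 (suc N)) (+-comm N 1)
    (AtMost-trans (AtMost-chars {f = f} N (<⇒≤ N<n)) (AtMost-char N<n))

  -- The parse of f (n - 1) ⋯ f 0 over the stretch f (e - 1) ⋯ f e′.
  AtMostDown : (ℕ → A) → ℕ → ℕ → ℕ → ℕ → Set _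
  AtMostDown f n e e′ x = AtMost (applyUpTo (λ i → f (n ∸ suc i)) n) (n ∸ e) (n ∸ e′) x

  module _ {f : ℕ → A} where

    private
      n∸suc[n∸e+i] : e ≤ n → ∀ i → n ∸ suc (n ∸ e + i) ≡ e ∸ suc i
      n∸suc[n∸e+i] {e} {n} e≤n i = trans (cong (n ∸_) (sym (+-suc (n ∸ e) i)))
        (trans (sym (∸-+-assoc n (n ∸ e) (suc i))) (cong (_∸ suc i) (m∸[m∸n]≡n e≤n)))

    AtMostDown-char : e < n → AtMostDown f n (suc e) e 1
    AtMostDown-char {e} {n} e<n =
      subst (λ b → AtMost (applyUpTo (λ i → f (n ∸ suc i)) n) (n ∸ suc e) b 1)
        (sym (+-∸-assoc 1 e<n)) (AtMost-char (∸-monoʳ-< z<s e<n))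

    -- Reversal turns what stands `d` positions later in `f` into an earlier source, at position
    -- `n ∸ (e + d)` of the reversed word.
    AtMostDown-copy : ∀ {d} → e′ ≤ e → 0 < d → e + d ≤ n →
                      (∀ {y} → e′ ≤ y → y < e → f (y + d) ≡ f y) → AtMostDown f n e e′ 1
    AtMostDown-copy {e′} {e} {n} {d} e′≤e 0<d e+d≤n same =
      subst (λ b → AtMost (applyUpTo (λ i → f (n ∸ suc i)) n) (n ∸ e) b 1) end
        (AtMost-copy (∸-monoʳ-< (m<m+n e 0<d) e+d≤n) (≤-trans (≤-reflexive end) (m∸n≤m n e′)) rep)
      where
      e≤n = m+n≤o⇒m≤o e e+d≤n
      end : n ∸ e + (e ∸ e′) ≡ n ∸ e′
      end = trans (sym (+-∸-assoc (n ∸ e) e′≤e)) (cong (_∸ e′) (m∸n+n≡m e≤n))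
      rep : Repeats (λ i → f (n ∸ suc i)) (n ∸ (e + d)) (n ∸ e) (e ∸ e′)
      rep {i} i< = begin
        f (n ∸ suc (n ∸ (e + d) + i)) ≡⟨ cong f (n∸suc[n∸e+i] e+d≤n i) ⟩
        f (e + d ∸ suc i)             ≡⟨ cong f (+-∸-comm d (≤-trans i< (m∸n≤m e e′))) ⟩
        f (e ∸ suc i + d)             ≡⟨ same e′≤ (∸-monoʳ-< z<s (≤-trans i< (m∸n≤m e e′))) ⟩
        f (e ∸ suc i)                 ≡⟨ cong f (n∸suc[n∸e+i] e≤n i) ⟨
        f (n ∸ suc (n ∸ e + i)) ∎
        where
        open ≡-Reasoning
        e′≤ : e′ ≤ e ∸ suc i
        e′≤ = subst (_≤ e ∸ suc i) (m∸[m∸n]≡n e′≤e) (∸-monoʳ-≤ e i<)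

    AtMostDown-iterate : ∀ {s w} N → (∀ {i} → i < N → AtMostDown f n (s + suc i * w) (s + i * w) x) →
                         AtMostDown f n (s + N * w) s (N * x)
    AtMostDown-iterate {s = s} zero P rewrite +-identityʳ s = AtMost-refl
    AtMostDown-iterate {s = s} {w = w} (suc N) P =
      AtMost-trans (P (n<1+n N)) (AtMostDown-iterate {s = s} {w = w} N (P ∘ m<n⇒m<1+n))

-- Even token splits and dyadic times.

module EvenSplit where

  open import Data.Nat.Base
  open import Data.Nat.Properties
  open import Data.Nat.Solver using (module +-*-Solver)

  -- share k c t is the number of tokens that cell c receives when t tokens are
  -- split over 2 ^ k cells as evenly as possible, halving recursively.
  share : ℕ → ℕ → ℕ → ℕ
  share zero    c t = t
  share (suc k) c t with c <? 2 ^ k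
  ... | yes _ = share k c ⌈ t /2⌉
  ... | no  _ = share k (c ∸ 2 ^ k) ⌊ t /2⌋

  share-left : ∀ k {c} t → c < 2 ^ k → share (suc k) c t ≡ share k c ⌈ t /2⌉
  share-left k {c} t c< with c <? 2 ^ k
  ... | yes _ = refl
  ... | no c≮ = contradiction c< c≮

  share-right : ∀ k c t → share (suc k) (2 ^ k + c) t ≡ share k c ⌊ t /2⌋
  share-right k c t with 2 ^ k + c <? 2 ^ k
  ... | yes lt = contradiction lt (m+n≮m (2 ^ k) c)
  ... | no _  = cong (λ c → share k c ⌊ t /2⌋) (m+n∸m≡n (2 ^ k) c)

  share-≤ : ∀ k c t → share k c t ≤ t
  share-≤ zero    c t = ≤-refl
  share-≤ (suc k) c t with c <? 2 ^ k
  ... | yes _ = ≤-trans (share-≤ k c _) (⌈n/2⌉≤n t)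
  ... | no  _ = ≤-trans (share-≤ k (c ∸ 2 ^ k) _) (⌊n/2⌋≤n t)

  n+n≡2*n : ∀ n → n + n ≡ 2 * n
  n+n≡2*n n = cong (n +_) (sym (+-identityʳ n))

  -- `⌊ suc t /2⌋` computes to `⌈ t /2⌉` and `⌈ suc t /2⌉` to `suc ⌊ t /2⌋`. So a new token enters
  -- the left half when `t` is even and the right half when `t` is odd, and recursion leads it to a
  -- single cell.
  share-suc : ∀ k t → ∃ λ x → x < 2 ^ k × (∀ {c} → c < 2 ^ k → c ≢ x → share k c (suc t) ≡ share k c t)
  share-suc zero t = 0 , z<s , λ c< c≢0 → contradiction (n<1⇒n≡0 c<) c≢0
  share-suc (suc k) t with ⌈t/2⌉-cases t
    where
    ⌈t/2⌉-cases : ∀ t → ⌈ t /2⌉ ≡ ⌊ t /2⌋ ⊎ ⌈ t /2⌉ ≡ suc ⌊ t /2⌋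
    ⌈t/2⌉-cases zero          = inj₁ refl
    ⌈t/2⌉-cases (suc zero)    = inj₂ refl
    ⌈t/2⌉-cases (suc (suc t)) = [ (λ e → inj₁ (cong suc e)) , (λ e → inj₂ (cong suc e)) ]′ (⌈t/2⌉-cases t)
  ... | inj₁ even with x , x< , same ← share-suc k ⌊ t /2⌋ =
    x , ≤-trans x< (m≤m+n _ _) , go
    where
    go : ∀ {c} → c < 2 ^ suc k → c ≢ x → share (suc k) c (suc t) ≡ share (suc k) c t
    go {c} _ c≢x with c <? 2 ^ k
    ... | yes c< = trans (same c< c≢x) (cong (share k c) (sym even))
    ... | no _   = cong (share k (c ∸ 2 ^ k)) even
  ... | inj₂ odd with x , x< , same ← share-suc k ⌊ t /2⌋ =
    2 ^ k + x , subst (2 ^ k + x <_) (n+n≡2*n (2 ^ k)) (+-monoʳ-< (2 ^ k) x<) , go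
    where
    go : ∀ {c} → c < 2 ^ suc k → c ≢ 2 ^ k + x → share (suc k) c (suc t) ≡ share (suc k) c t
    go {c} c< c≢ with c <? 2 ^ k
    ... | yes _  = cong (share k c) (sym odd)
    ... | no c≮ with o , refl ← m≤n⇒∃[o]m+o≡n (≮⇒≥ c≮) rewrite m+n∸m≡n (2 ^ k) o =
      trans (cong (share k o) odd)
            (same (+-cancelˡ-< (2 ^ k) o (2 ^ k) (subst (2 ^ k + o <_) (sym (n+n≡2*n (2 ^ k))) c<))
                  (λ e → c≢ (cong (2 ^ k +_) e)))

  -- If the floors of the halves agree, the ceilings must differ strictly, so one of the two halves
  -- again receives different amounts.
  share-differs : ∀ k {t u} → t < u → ∃ λ c → c < 2 ^ k × share k c t ≢ share k c u
  share-differs zero t<u = 0 , z<s , <⇒≢ t<u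
  share-differs (suc k) {t} {u} t<u with ⌊ t /2⌋ <? ⌊ u /2⌋
  ... | yes lt with c , c< , neq ← share-differs k lt =
    2 ^ k + c , subst (2 ^ k + c <_) (n+n≡2*n (2 ^ k)) (+-monoʳ-< (2 ^ k) c<) ,
    subst₂ _≢_ (sym (share-right k c t)) (sym (share-right k c u)) neq
  ... | no ge with c , c< , neq ← share-differs k {⌈ t /2⌉} {⌈ u /2⌉}
                   (≤-trans (s≤s (≤-trans (⌊n/2⌋-mono t<u) (≮⇒≥ ge))) (⌈n/2⌉-mono t<u)) =
    c , ≤-trans c< (m≤m+n _ _) ,
    subst₂ _≢_ (sym (share-left k t c<)) (sym (share-left k u c<)) neq

  ⌊n+2*m/2⌋ : ∀ n m → ⌊ n + 2 * m /2⌋ ≡ ⌊ n /2⌋ + m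
  ⌊n+2*m/2⌋ n zero    = trans (cong ⌊_/2⌋ (+-identityʳ n)) (sym (+-identityʳ _))
  ⌊n+2*m/2⌋ n (suc m) = trans (cong ⌊_/2⌋ eq) (trans (cong suc (⌊n+2*m/2⌋ n m)) (sym (+-suc _ m)))
    where
    eq : n + 2 * suc m ≡ 2 + (n + 2 * m)
    eq = solve 2 (λ n m → n :+ con 2 :* (con 1 :+ m) := con 2 :+ (n :+ con 2 :* m)) refl n m
      where open +-*-Solver

  -- Halving takes a gap of `2 ^ suc d` to a gap of at least `2 ^ d` in both halves. After `d`
  -- halvings every window still has a gap of at least 1, and `share-differs` applies inside it.
  share-separates : ∀ d j {t u w} → t + 2 ^ d ≤ u → w < 2 ^ d →
    ∃ λ c → c < 2 ^ j × share (d + j) (w * 2 ^ j + c) t ≢ share (d + j) (w * 2 ^ j + c) u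
  share-separates zero j {t} {u} {zero} gap w< = share-differs j (subst (_≤ u) (+-comm t 1) gap)
  share-separates zero j {w = suc _} gap (s<s ())
  share-separates (suc d) j {t} {u} {w} gap w< with w <? 2 ^ d
  ... | yes w<2^d =
    let c , c< , neq = share-separates d j {⌈ t /2⌉} {⌈ u /2⌉} {w}
          (subst (_≤ ⌈ u /2⌉) (⌊n+2*m/2⌋ (suc t) (2 ^ d)) (⌈n/2⌉-mono gap)) w<2^d
        inside : w * 2 ^ j + c < 2 ^ (d + j)
        inside = subst (w * 2 ^ j + c <_) (sym (^-distribˡ-+-* 2 d j))
          (≤-trans (+-monoʳ-< (w * 2 ^ j) c<)
            (≤-trans (≤-reflexive (+-comm (w * 2 ^ j) (2 ^ j))) (*-monoˡ-≤ (2 ^ j) w<2^d)))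
    in c , c< , subst₂ _≢_ (sym (share-left (d + j) t inside)) (sym (share-left (d + j) u inside)) neq
  ... | no w≮2^d with v , refl ← m≤n⇒∃[o]m+o≡n (≮⇒≥ w≮2^d) =
    let c , c< , neq = share-separates d j {⌊ t /2⌋} {⌊ u /2⌋} {v}
          (subst (_≤ ⌊ u /2⌋) (⌊n+2*m/2⌋ t (2 ^ d)) (⌊n/2⌋-mono gap))
          (+-cancelˡ-< (2 ^ d) v (2 ^ d) (subst (2 ^ d + v <_) (sym (n+n≡2*n (2 ^ d))) w<))
        column : 2 ^ (d + j) + (v * 2 ^ j + c) ≡ (2 ^ d + v) * 2 ^ j + c
        column = trans (cong (_+ (v * 2 ^ j + c)) (^-distribˡ-+-* 2 d j))
          (trans (sym (+-assoc (2 ^ d * 2 ^ j) (v * 2 ^ j) c))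
                 (cong (_+ c) (sym (*-distribʳ-+ (2 ^ j) (2 ^ d) v))))
        right = λ t → trans (cong (λ x → share (suc d + j) x t) (sym column))
                            (share-right (d + j) (v * 2 ^ j + c) t)
    in c , c< , subst₂ _≢_ (sym (right t)) (sym (right u)) neq

  -- For i < 2 ^ j and j < k, dyadic k (2 ^ j + i) is (2 i + 1) 2 ^ (k - 1 - j).
  dyadic : ℕ → ℕ → ℕ
  dyadic zero    r = 0
  dyadic (suc k) r with r <? 2 ^ k
  ... | yes _ = 2 * dyadic k r
  ... | no  _ = suc (2 * (r ∸ 2 ^ k))

  dyadic-< : ∀ k {r} → r < 2 ^ k → dyadic k r < 2 ^ k
  dyadic-< zero    r< = z<s
  dyadic-< (suc k) {r} r< with r <? 2 ^ k
  ... | yes r<2^k = *-monoʳ-< 2 (dyadic-< k r<2^k)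
  ... | no  r≮2^k with i , refl ← m≤n⇒∃[o]m+o≡n (≮⇒≥ r≮2^k) rewrite m+n∸m≡n (2 ^ k) i =
    subst (_≤ 2 * 2 ^ k) (*-suc 2 i)
      (*-monoʳ-≤ 2 (+-cancelˡ-< (2 ^ k) i (2 ^ k) (subst (2 ^ k + i <_) (sym (n+n≡2*n (2 ^ k))) r<)))

  Apart : ℕ → ℕ → ℕ → Set
  Apart g t u = t + g ≤ u ⊎ u + g ≤ t

  -- Times of level `j` are odd multiples of `2 ^ d`, and those of all earlier rows are other
  -- multiples of it. For `d = 0` this is parity against the coarser levels and monotonicity within
  -- the level; each further step doubles all times.
  dyadic-apart : ∀ d j {r q} → 2 ^ j ≤ r → r < 2 ^ suc j → q < r →
                 Apart (2 ^ d) (dyadic (d + suc j) q) (dyadic (d + suc j) r)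
  dyadic-apart zero j {r} {q} 2^j≤r r< q<r with r <? 2 ^ j | q <? 2 ^ j
  ... | yes r<2^j | _      = contradiction 2^j≤r (<⇒≱ r<2^j)
  ... | no _      | no q≮  = inj₁
    (≤-trans (≤-reflexive (+-comm _ 1)) (s<s (*-monoʳ-< 2 (∸-monoˡ-< q<r (≮⇒≥ q≮)))))
  ... | no _      | yes q< with dyadic j q ≤? r ∸ 2 ^ j
  ...   | yes le = inj₁ (≤-trans (≤-reflexive (+-comm _ 1)) (s≤s (*-monoʳ-≤ 2 le)))
  ...   | no gt   = inj₂
    (≤-trans (≤-reflexive (trans (+-comm _ 1) (sym (*-suc 2 (r ∸ 2 ^ j)))))
             (*-monoʳ-≤ 2 (≰⇒> gt)))
  dyadic-apart (suc d) j {r} {q} 2^j≤r r< q<r with r <? 2 ^ (d + suc j) | q <? 2 ^ (d + suc j)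
  ... | no r≮ | _      = contradiction (≤-trans r< (^-monoʳ-≤ 2 (m≤n+m (suc j) d))) r≮
  ... | yes _ | no q≮  = contradiction (<-trans q<r (≤-trans r< (^-monoʳ-≤ 2 (m≤n+m (suc j) d)))) q≮
  ... | yes _ | yes _ = [ (λ le → inj₁ (double _ le)) , (λ le → inj₂ (double _ le)) ]′
    (dyadic-apart d j 2^j≤r r< q<r)
    where
    double : ∀ t {u} → t + 2 ^ d ≤ u → 2 * t + 2 ^ suc d ≤ 2 * u
    double t {u} le = subst (_≤ 2 * u) (*-distribˡ-+ 2 t (2 ^ d)) (*-monoʳ-≤ 2 le)

-- The word built from rows of shares.

module Construction (k : ℕ) where

  open Greedy
  open EvenSplit
  open import Data.Nat.Base
  open import Data.Nat.Divisibility using (n∣m*n)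
  open import Data.Nat.DivMod
  open import Data.Nat.Properties
  open import Data.Nat.Solver using (module +-*-Solver)


  m : ℕ
  m = 2 ^ k

  instance
    m≢0 : NonZero m
    m≢0 = m^n≢0 2 k

  -- Rows 0 to m - 1 are dyadic, rows m to 2 m run through the times 0 to m, and the
  -- time m is repeated ever after, which pads the word to any length.
  time : ℕ → ℕ
  time r with r <? m
  ... | yes _ = dyadic k r
  ... | no  _ = (r ∸ m) ⊓ m

  time-dyadic : ∀ {r} → r < m → time r ≡ dyadic k r
  time-dyadic {r} r<m with r <? m
  ... | yes _  = refl
  ... | no r≮m = contradiction r<m r≮m

  time-spine : ∀ {t} → t ≤ m → time (m + t) ≡ t
  time-spine {t} t≤m with m + t <? m
  ... | yes lt = contradiction lt (m+n≮m m t)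
  ... | no _   = trans (cong (_⊓ m) (m+n∸m≡n m t)) (m≤n⇒m⊓n≡m t≤m)

  time-const : ∀ {r} → m + m ≤ r → time r ≡ m
  time-const {r} 2m≤r with r <? m
  ... | yes r<m = contradiction (≤-trans (m≤m+n m m) 2m≤r) (<⇒≱ r<m)
  ... | no _    = m≥n⇒m⊓n≡n (subst (_≤ r ∸ m) (m+n∸m≡n m m) (∸-monoˡ-≤ m 2m≤r))

  time-≤ : ∀ r → time r ≤ m
  time-≤ r with r <? m
  ... | yes r<m = <⇒≤ (dyadic-< k r<m)
  ... | no _    = m⊓n≤n (r ∸ m) m

  entry : ℕ → ℕ
  entry y = share k (y % m) (time (y / m))

  -- Tagging an entry with its column forces repetitions to be aligned with the rows.
  symbol : ℕ → Fin (m * suc m)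
  symbol y = combine (y mod m) (entry y mod suc m)

  private
    toℕ-mod : ∀ y n .{{_ : NonZero n}} → Fin.toℕ (y mod n) ≡ y % n
    toℕ-mod y n = toℕ-fromℕ< (m%n<n y n)

    mod-injective : ∀ x y n .{{_ : NonZero n}} → x mod n ≡ y mod n → x % n ≡ y % n
    mod-injective x y n eq =
      trans (sym (toℕ-mod x n)) (trans (cong Fin.toℕ eq) (toℕ-mod y n))

    -- Shares never exceed the time, which is at most `m`, so the reduction modulo `suc m` in
    -- `symbol` loses no information.
    entry-small : ∀ y → entry y % suc m ≡ entry y
    entry-small y = m<n⇒m%n≡m (s≤s (≤-trans (share-≤ k (y % m) _) (time-≤ (y / m))))

    [c+rm]%m : ∀ r {c} → c < m → (r * m + c) % m ≡ c
    [c+rm]%m r {c} c<m = trans (cong (_% m) (+-comm (r * m) c)) (trans ([m+kn]%n≡m%n c r m) (m<n⇒m%n≡m c<m))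

    [y+rm]/m : ∀ y r → (y + r * m) / m ≡ y / m + r
    [y+rm]/m y r = trans (+-distrib-/-∣ʳ y (n∣m*n r)) (cong (y / m +_) (m*n/n≡m r m))

    [c+rm]/m : ∀ r {c} → c < m → (r * m + c) / m ≡ r
    [c+rm]/m r {c} c<m = trans (cong (_/ m) (+-comm (r * m) c))
      (trans ([y+rm]/m c r) (cong (_+ r) (m<n⇒m/n≡0 c<m)))

    y≡rm+c : ∀ y → y ≡ y / m * m + y % m
    y≡rm+c y = trans (m≡m%n+[m/n]*n y m) (+-comm (y % m) _)

  symbol-shift : ∀ {y} r → share k (y % m) (time (y / m + r)) ≡ entry y → symbol (y + r * m) ≡ symbol y
  symbol-shift {y} r eq = cong₂ combine
    (toℕ-injective (trans (toℕ-mod _ m) (trans column (sym (toℕ-mod y m)))))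
    (cong (_mod suc m) (trans (cong₂ (λ c r → share k c (time r)) column ([y+rm]/m y r)) eq))
    where
    column : (y + r * m) % m ≡ y % m
    column = [m+kn]%n≡m%n y r m

  symbol-injective : ∀ q r {c c′} → c < m → c′ < m → symbol (q * m + c) ≡ symbol (r * m + c′) →
                     c ≡ c′ × share k c (time q) ≡ share k c (time r)
  symbol-injective q r {c} {c′} c<m c′<m eq
    with eq₁ , eq₂ ← combine-injective ((q * m + c) mod m) (entry (q * m + c) mod suc m)
                                       ((r * m + c′) mod m) (entry (r * m + c′) mod suc m) eq =
    columns , trans (sym (row q c<m)) (trans entries
      (trans (row r c′<m) (cong (λ c → share k c (time r)) (sym columns))))
    where
    row : ∀ r {c} → c < m → entry (r * m + c) ≡ share k c (time r)
    row r c<m = cong₂ (λ c r → share k c (time r)) ([c+rm]%m r c<m) ([c+rm]/m r c<m)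
    columns : c ≡ c′
    columns = trans (sym ([c+rm]%m q c<m))
      (trans (mod-injective (q * m + c) (r * m + c′) m eq₁) ([c+rm]%m r c′<m))
    entries : entry (q * m + c) ≡ entry (r * m + c′)
    entries = trans (sym (entry-small (q * m + c)))
        (trans (mod-injective (entry (q * m + c)) (entry (r * m + c′)) (suc m) eq₂)
               (entry-small (r * m + c′)))

  -- Upper bound for the reversed word.

  module _ {n : ℕ} (n≥ : suc (m + m) * m ≤ n) where

    -- The bound `n≥` leaves space for rows 0 to 2 m, that is `suc (m + m)` rows of width `m`.
    word reversed : List (Fin (m * suc m))
    word     = applyUpTo symbol n
    reversed = applyUpTo (λ i → symbol (n ∸ suc i)) n

    private
      Down : ℕ → ℕ → ℕ → Set
      Down = AtMostDown symbol n

      copy-rows : ∀ {e e′} r → e′ ≤ e → e + suc r * m ≤ n →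
                  (∀ {y} → e′ ≤ y → y < e → share k (y % m) (time (y / m + suc r)) ≡ entry y) →
                  Down e e′ 1
      copy-rows r e′≤e fits same =
        AtMostDown-copy {f = symbol} e′≤e (>-nonZero⁻¹ (suc r * m) {{m*n≢0 (suc r) m}}) fits
          λ e′≤y y<e → symbol-shift (suc r) (same e′≤y y<e)

      ≤-row : ∀ {r y} → r * m ≤ y → r ≤ y / m
      ≤-row {r} {y} le = subst (_≤ y / m) (m*n/n≡m r m) (/-monoˡ-≤ m le)

      in-row : ∀ {r y} → r * m ≤ y → y < suc r * m → y / m ≡ r
      in-row {r} {y} lo hi = ≤-antisym (s≤s⁻¹ (m<n*o⇒m/o<n hi)) (≤-row lo)

      -- From row 2 m on the word has period `m`, so after its first `m` symbols the reversal needs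
      -- one self-overlapping copy for all the padding, even if the last row is incomplete.
      constant-rows : Down (n ∸ m) ((m + m) * m) 1
      constant-rows = copy-rows 0 (m+n≤o⇒m≤o∸n _ (subst (_≤ n) (+-comm m _) n≥))
        (≤-reflexive (trans (cong (n ∸ m +_) (+-identityʳ m)) (m∸n+n≡m (m+n≤o⇒m≤o m n≥))))
        λ {y} lo _ → let high = ≤-row {m + m} lo in
          cong (share k (y % m))
            (trans (time-const (≤-trans high (m≤m+n _ 1))) (sym (time-const high)))

      -- The row of time `suc t`, just read in the reversal, differs only in the column `x` of
      -- `share-suc`. The phrases are a copy of what lies right of `x`, the symbol at `x`, and a
      -- copy of what lies left of it.
      spine-row : ∀ {t} → t < m → Down (m * m + suc t * m) (m * m + t * m) 3
      spine-row {t} t<m with x , x<m , same ← share-suc k t =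
        subst₂ (λ e e′ → Down e e′ 3) (trans (cong (_* m) (sym (+-suc m t))) (distrib (suc t))) (distrib t)
          (AtMost-trans right (AtMost-trans char left))
        where
        r = m + t
        distrib : ∀ t → (m + t) * m ≡ m * m + t * m
        distrib t = *-distribʳ-+ m m t
        fits : suc r * m + 1 * m ≤ n
        fits = ≤-trans (≤-reflexive (trans (sym (*-distribʳ-+ m (suc r) 1)) (cong (_* m) (+-comm (suc r) 1))))
          (≤-trans (*-monoˡ-≤ m (s≤s (subst (_≤ m + m) (+-suc m t) (+-monoʳ-≤ m t<m)))) n≥)
        end≤ : r * m + suc x ≤ suc r * m
        end≤ = subst (r * m + suc x ≤_) (+-comm (r * m) m) (+-monoʳ-≤ (r * m) x<m)
        unchanged : ∀ {y} → r * m ≤ y → y < suc r * m → y ≢ r * m + x →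
                share k (y % m) (time (y / m + 1)) ≡ entry y
        unchanged {y} lo hi y≢ rewrite in-row {r} lo hi = begin
          share k (y % m) (time (r + 1))
            ≡⟨ cong (share k (y % m))
                 (trans (cong time (trans (+-comm r 1) (sym (+-suc m t)))) (time-spine t<m)) ⟩
          share k (y % m) (suc t)
            ≡⟨ same (m%n<n y m) (λ eq →
                 y≢ (trans (y≡rm+c y) (cong₂ (λ r c → r * m + c) (in-row {r} lo hi) eq))) ⟩
          share k (y % m) t              ≡⟨ cong (share k (y % m)) (time-spine (<⇒≤ t<m)) ⟨
          share k (y % m) (time r) ∎
          where open ≡-Reasoning
        right : Down (suc r * m) (r * m + suc x) 1
        right = copy-rows 0 end≤ fits λ lo hi →
          unchanged (≤-trans (m≤m+n (r * m) (suc x)) lo) hi (λ { refl → <⇒≱ (+-monoʳ-< (r * m) (n<1+n x)) lo })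
        char : Down (r * m + suc x) (r * m + x) 1
        char = subst (λ e → Down e (r * m + x) 1) (sym (+-suc (r * m) x))
          (AtMostDown-char {f = symbol}
            (≤-trans (≤-reflexive (sym (+-suc (r * m) x))) (≤-trans end≤ (m+n≤o⇒m≤o _ fits))))
        left : Down (r * m + x) (r * m) 1
        left = copy-rows 0 (m≤m+n _ x)
          (≤-trans (+-monoˡ-≤ (1 * m) (≤-trans (+-monoʳ-≤ (r * m) (n≤1+n x)) end≤)) fits) λ lo hi →
          unchanged lo (≤-trans hi (≤-trans (+-monoʳ-≤ (r * m) (n≤1+n x)) end≤)) (<⇒≢ hi)

      m<n⇒∃[o]m+1+o≡n : ∀ {m n} → m < n → ∃ λ o → m + suc o ≡ n
      m<n⇒∃[o]m+1+o≡n {m} m<n with o , eq ← m≤n⇒∃[o]m+o≡n m<n = o , trans (+-suc m o) eq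

      -- Row `m + dyadic k r` has the same time; it lies `suc s` rows later in the word, hence
      -- earlier in the reversal.
      dyadic-row : ∀ {r} → r < m → Down (suc r * m) (r * m) 1
      dyadic-row {r} r<m with s , eq ← m<n⇒∃[o]m+1+o≡n (≤-trans r<m (m≤m+n m (dyadic k r))) =
        copy-rows s (m≤n+m _ m)
          (≤-trans (≤-reflexive (trans (sym (*-distribʳ-+ m (suc r) (suc s))) (cong (λ r → suc r * m) eq)))
            (≤-trans (*-monoˡ-≤ m (s≤s (+-monoʳ-≤ m (<⇒≤ (dyadic-< k r<m))))) n≥))
          λ {y} lo hi → cong (share k (y % m)) (begin
            time (y / m + suc s)    ≡⟨ cong (λ r → time (r + suc s)) (in-row {r} lo hi) ⟩
            time (r + suc s)        ≡⟨ cong time eq ⟩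
            time (m + dyadic k r)   ≡⟨ time-spine (<⇒≤ (dyadic-< k r<m)) ⟩
            dyadic k r              ≡⟨ time-dyadic r<m ⟨
            time r                  ≡⟨ cong time (in-row {r} lo hi) ⟨
            time (y / m) ∎)
        where
        open ≡-Reasoning

    reversed-phrases : AtMost reversed 0 n (6 * m)
    reversed-phrases = AtMost-mono total
      (AtMost-trans (AtMost-chars m m≤n)
        (AtMost-trans (subst (λ b → AtMost reversed b (n ∸ (m + m) * m) 1) (m∸[m∸n]≡n m≤n) constant-rows)
          (AtMost-trans (subst (λ e → Down e (m * m) (m * 3)) (sym (*-distribʳ-+ m m m))
                          (AtMostDown-iterate {f = symbol} {s = m * m} {w = m} m spine-row))
            (AtMostDown-iterate {f = symbol} {s = 0} {w = m} m dyadic-row))))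
      where
      m≤n : m ≤ n
      m≤n = m+n≤o⇒m≤o m n≥
      -- The summands are the first `m` symbols one by one, the padding, three phrases per spine row
      -- and one per dyadic row; the lone 1 is absorbed by `1 ≤ m`.
      total : m + (1 + (m * 3 + m * 1)) ≤ 6 * m
      total = ≤-trans (+-monoʳ-≤ m (+-monoˡ-≤ (m * 3 + m * 1) (>-nonZero⁻¹ m)))
        (≤-reflexive (solve 1 (λ m → m :+ (m :+ (m :* con 3 :+ m :* con 1)) := con 6 :* m) refl m))
        where open +-*-Solver

    -- Lower bound for the forward word.

    module _ {d j : ℕ} (k≡ : k ≡ d + suc j) where

      private
        w = 2 ^ suc j

        windows : 2 ^ d * w ≡ m
        windows = trans (sym (^-distribˡ-+-* 2 d (suc j))) (cong (2 ^_) (sym k≡))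

        window-fits : ∀ {i c} → i < 2 ^ d → c < w → i * w + c < m
        window-fits {i} {c} i< c< = ≤-trans (+-monoʳ-< (i * w) c<)
          (≤-trans (≤-reflexive (+-comm (i * w) w)) (subst (suc i * w ≤_) windows (*-monoˡ-≤ w i<)))

        differ : ∀ {q r i} → 2 ^ j ≤ r → r < 2 ^ suc j → r < m → q < r → i < 2 ^ d →
                 ∃ λ c → c < w × share k (i * w + c) (time q) ≢ share k (i * w + c) (time r)
        differ {q} {r} {i} lo hi r<m q<r i<
          rewrite time-dyadic r<m | time-dyadic (<-trans q<r r<m) | k≡ with dyadic-apart d j lo hi q<r
        ... | inj₁ gap = share-separates d (suc j) gap i<
        ... | inj₂ gap with c , c< , neq ← share-separates d (suc j) gap i< = c , c< , neq ∘ sym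

        -- The tag of the first symbol forces a source to start in the same column, hence at the
        -- same window of an earlier row `q`. By `differ`, some symbol of the window then disagrees.
        novel : ∀ {r i} → 2 ^ j ≤ r → r < 2 ^ suc j → r < m → i < 2 ^ d →
                ∀ {p} → p < r * m + i * w → ¬ Repeats symbol p (r * m + i * w) w
        novel {r} {i} lo hi r<m i< {p} p< rep =
          let c , c< , neq = differ {i = i} lo hi r<m q<r i<
          in neq (proj₂ (symbol-injective q r (window-fits i< c<) (window-fits i< c<)
               (subst₂ (λ a b → symbol a ≡ symbol b)
                 (trans (cong (_+ c) p≡) (+-assoc (q * m) (i * w) c)) (+-assoc (r * m) (i * w) c) (rep c<))))
          where
          q = p / m
          start : i * w < m
          start = subst (_< m) (+-identityʳ (i * w)) (window-fits i< (m^n>0 2 (suc j)))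
          column : p % m ≡ i * w
          column = proj₁ (symbol-injective q r (m%n<n p m) start
            (subst₂ (λ a b → symbol a ≡ symbol b) (trans (+-identityʳ p) (y≡rm+c p))
                    (+-identityʳ (r * m + i * w)) (rep (m^n>0 2 (suc j)))))
          p≡ : p ≡ q * m + i * w
          p≡ = trans (y≡rm+c p) (cong (q * m +_) column)
          q<r : q < r
          q<r = *-cancelʳ-< m q r (+-cancelʳ-< (i * w) (q * m) (r * m) (subst (_< r * m + i * w) p≡ p<))

        row : ∀ {r} → 2 ^ j ≤ r → r < 2 ^ suc j → r < m →
              AtLeast word (r * m) (suc r * m) (2 ^ d)
        row {r} lo hi r<m = subst₂ (AtLeast word (r * m))
          (trans (cong (r * m +_) windows) (+-comm (r * m) m)) (*-identityʳ (2 ^ d))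
          (AtLeast-iterate (2 ^ d) λ {i} i< →
            AtLeast-novel (+-monoʳ-< (r * m) (m<n+m (i * w) (m^n>0 2 (suc j))))
              (≤-trans (+-monoʳ-≤ (r * m) (subst (suc i * w ≤_) windows (*-monoˡ-≤ w i<)))
                (≤-trans (≤-reflexive (+-comm (r * m) m))
                  (≤-trans (*-monoˡ-≤ m (≤-trans r<m (≤-trans (m≤m+n m m) (n≤1+n _)))) n≥)))
              λ {p} p< → subst (λ ℓ → ¬ Repeats symbol p (r * m + i * w) ℓ) (sym (width r i))
                (novel lo hi r<m i< p<))
          where
          width : ∀ r i → r * m + suc i * w ∸ (r * m + i * w) ≡ w
          width r i = trans ([m+n]∸[m+o]≡n∸o (r * m) (suc i * w) (i * w)) (m+n∸n≡m w (i * w))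

      level : AtLeast word (2 ^ j * m) (2 ^ suc j * m) (2 ^ j * 2 ^ d)
      level = subst (λ e → AtLeast word (2 ^ j * m) e (2 ^ j * 2 ^ d)) end
        (AtLeast-iterate (2 ^ j) λ {i} i< →
          let r<w = subst (2 ^ j + i <_) (n+n≡2*n (2 ^ j)) (+-monoʳ-< (2 ^ j) i<)
          in subst₂ (λ b e → AtLeast word b e (2 ^ d)) (*-distribʳ-+ m (2 ^ j) i)
               (trans (cong (_* m) (sym (+-suc (2 ^ j) i))) (*-distribʳ-+ m (2 ^ j) (suc i)))
               (row (m≤m+n (2 ^ j) i) r<w
                 (≤-trans r<w (subst (λ k → w ≤ 2 ^ k) (sym k≡) (^-monoʳ-≤ 2 (m≤n+m (suc j) d))))))
        where
        end : 2 ^ j * m + 2 ^ j * m ≡ 2 ^ suc j * m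
        end = trans (sym (*-distribʳ-+ m (2 ^ j) (2 ^ j))) (cong (_* m) (n+n≡2*n (2 ^ j)))

    -- Level `j` has `2 ^ j` rows with `2 ^ d` new windows each, and `j + d` is `pred k`, so all
    -- levels contribute equally. Counting starts at row 1, the only row of level 0.
    levels : ∀ j → j ≤ k → AtLeast word (1 * m) (2 ^ j * m) (j * 2 ^ pred k)
    levels zero    _   = AtLeast-refl
    levels (suc j) j<k with d , eq ← m≤n⇒∃[o]m+o≡n j<k =
      subst (AtLeast word (1 * m) (2 ^ suc j * m))
        (trans (cong (j * 2 ^ pred k +_) size) (+-comm (j * 2 ^ pred k) _))
        (AtLeast-trans (levels j (<⇒≤ j<k)) (level {d} {j} (trans (sym eq) (+-comm (suc j) d))))
      where
      size : 2 ^ j * 2 ^ d ≡ 2 ^ pred k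
      size = trans (sym (^-distribˡ-+-* 2 j d)) (cong (λ k → 2 ^ pred k) eq)

    forward-phrases : AtLeast word 0 (m * m) (k * 2 ^ pred k)
    forward-phrases b≤0 = levels k ≤-refl (≤-trans b≤0 z≤n)

  z-reversed : ∀ {n} (n≥ : suc (m + m) * m ≤ n) → z (applyDownFrom symbol n) ≤ 6 * m
  z-reversed {n} n≥ = AtMost-end
    (subst (λ e → AtMost X 0 e (6 * m)) (sym (length-applyDownFrom symbol n))
      (subst (λ S → AtMost S 0 n (6 * m)) (sym (applyDownFrom≡applyUpTo symbol n)) (reversed-phrases n≥)))
    (proj₂ (lz Fin._≟_ X))
    where
    X = applyDownFrom symbol n

  z-forward : ∀ {n} (n≥ : suc (m + m) * m ≤ n) → k * 2 ^ pred k ≤ z (applyUpTo symbol n)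
  z-forward {n} n≥ = AtLeast-end (forward-phrases n≥) (proj₂ (lz Fin._≟_ (applyUpTo symbol n)))

-- Choice of `k` and the constant.

module Ratio where

  open import Data.Nat.Base
  open import Data.Nat.DivMod
  open import Data.Nat.Properties
  open import Data.Nat.Solver using (module +-*-Solver)

  -- The rows need at most four times `2 ^ k * 2 ^ k` symbols, which is `2 ^ (2 * k + 2)`; the
  -- hypothesis on the logarithm puts `n` above that.
  room : ∀ k n → 1 ≤ k → 2 * k + 2 < ⌈log₂ n ⌉ → suc (2 ^ k + 2 ^ k) * 2 ^ k ≤ n
  room k n 1≤k k< = begin
    suc (2 ^ k + 2 ^ k) * 2 ^ k  ≤⟨ *-monoˡ-≤ (2 ^ k) (+-monoˡ-≤ (2 ^ k + 2 ^ k) (m^n>0 2 k)) ⟩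
    (2 ^ k + (2 ^ k + 2 ^ k)) * 2 ^ k
      ≤⟨ *-monoˡ-≤ (2 ^ k) (m≤n+m _ (2 ^ k)) ⟩
    (2 ^ k + (2 ^ k + (2 ^ k + 2 ^ k))) * 2 ^ k
      ≡⟨ solve 1 (λ m → (m :+ (m :+ (m :+ m))) :* m := m :* m :* con 4) refl (2 ^ k) ⟩
    2 ^ k * 2 ^ k * 4            ≡⟨ cong (_* 4) (^-distribˡ-+-* 2 k k) ⟨
    2 ^ (k + k) * 2 ^ 2          ≡⟨ ^-distribˡ-+-* 2 (k + k) 2 ⟨
    2 ^ (k + k + 2)              ≡⟨ cong (λ l → 2 ^ (k + l + 2)) (+-identityʳ k) ⟨
    2 ^ (2 * k + 2)              ≤⟨ <⇒≤ (≰⇒> too-big) ⟩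
    n ∎
    where
    open ≤-Reasoning
    open +-*-Solver
    too-big : ¬ n ≤ 2 ^ (2 * k + 2)
    too-big n≤ = <⇒≱ k< (≤-trans (⌈log₂⌉-mono-≤ n≤) (≤-reflexive (⌈log₂2^n⌉≡n (2 * k + 2))))

  ratio : ∀ n → 64 ≤ n → ∃[ σ ] ∃[ X ] (length {A = Fin σ} X ≡ n ×
          ⌈log₂ n ⌉ * z X ≤ 84 * z (reverse X))
  ratio n 64≤n = _ , applyDownFrom symbol n , length-applyDownFrom symbol n , (begin
    l * z (applyDownFrom symbol n) ≤⟨ *-mono-≤ l≤7k (z-reversed fits) ⟩
    7 * k * (6 * 2 ^ k)            ≡⟨ cong (λ i → 7 * k * (6 * 2 ^ i)) (suc-pred k {{>-nonZero 1≤k}}) ⟨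
    7 * k * (6 * (2 * 2 ^ pred k))
      ≡⟨ solve 2 (λ k h → con 7 :* k :* (con 6 :* (con 2 :* h)) := con 84 :* (k :* h)) refl k (2 ^ pred k) ⟩
    84 * (k * 2 ^ pred k)          ≤⟨ *-monoʳ-≤ 84 (z-forward fits) ⟩
    84 * z (applyUpTo symbol n)    ≡⟨ cong (λ S → 84 * z S) (reverse-applyDownFrom symbol n) ⟨
    84 * z (reverse (applyDownFrom symbol n)) ∎)
    where
    open ≤-Reasoning
    open +-*-Solver
    l = ⌈log₂ n ⌉
    -- The word has order `2 ^ (2 * k)` symbols, so `k` may be a constant fraction of `l`; a quarter
    -- satisfies `room` once `l > 4`, and `6 ≤ l` also gives `1 ≤ k`.
    k = l / 4
    open Construction k
    6≤l : 6 ≤ l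
    6≤l = ≤-trans (≤-reflexive (sym (⌈log₂2^n⌉≡n 6))) (⌈log₂⌉-mono-≤ 64≤n)
    1≤k : 1 ≤ k
    1≤k = m≥n⇒m/n>0 (≤-trans (m≤m+n 4 2) 6≤l)
    fits : suc (2 ^ k + 2 ^ k) * 2 ^ k ≤ n
    fits = room k n 1≤k (*-cancelˡ-< 2 _ l (begin-strict
      2 * (2 * k + 2) ≡⟨ solve 1 (λ k → con 2 :* (con 2 :* k :+ con 2) := k :* con 4 :+ con 4) refl k ⟩
      k * 4 + 4       ≤⟨ +-monoˡ-≤ 4 (m/n*n≤m l 4) ⟩
      l + 4           <⟨ +-monoʳ-< l (≤-trans (m≤m+n 5 1) 6≤l) ⟩
      l + l           ≡⟨ cong (l +_) (+-identityʳ l) ⟨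
      2 * l ∎))
    -- The remainder modulo 4 is at most 3, hence at most `3 * k`. With the factor 6 of `z-reversed`
    -- and the 2 in `2 ^ k` this 7 makes up 84.
    l≤7k : l ≤ 7 * k
    l≤7k = begin
      l             ≡⟨ m≡m%n+[m/n]*n l 4 ⟩
      l % 4 + k * 4 ≤⟨ +-monoˡ-≤ (k * 4) (s≤s⁻¹ (m%n<n l 4)) ⟩
      3 * 1 + k * 4 ≤⟨ +-monoˡ-≤ (k * 4) (*-monoʳ-≤ 3 1≤k) ⟩
      3 * k + k * 4 ≡⟨ solve 1 (λ k → con 3 :* k :+ k :* con 4 := con 7 :* k) refl k ⟩
      7 * k ∎

  -- Unnormalised rationals bypass the reduction to lowest terms, leaving the integer
  -- cross-multiplication `ineq`.
  scale : ∀ i j l → i * j ≤ 84 * l →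
          (ℤ.+ 1 ℚ./ 84) ℚ.* (ℤ.+ i ℚ./ 1) ℚ.* (ℤ.+ j ℚ./ 1) ℚ.≤ ℤ.+ l ℚ./ 1
  scale i j l ij≤84l = ℚ.toℚᵘ-cancel-≤ (begin
    ℚ.toℚᵘ ((ℤ.+ 1 ℚ./ 84) ℚ.* (ℤ.+ i ℚ./ 1) ℚ.* (ℤ.+ j ℚ./ 1))
      ≃⟨ ℚ.toℚᵘ-homo-* ((ℤ.+ 1 ℚ./ 84) ℚ.* (ℤ.+ i ℚ./ 1)) (ℤ.+ j ℚ./ 1) ⟩
    ℚ.toℚᵘ ((ℤ.+ 1 ℚ./ 84) ℚ.* (ℤ.+ i ℚ./ 1)) ℚᵘ.* ℚ.toℚᵘ (ℤ.+ j ℚ./ 1)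
      ≃⟨ ℚᵘ.*-cong (ℚ.toℚᵘ-homo-* (ℤ.+ 1 ℚ./ 84) (ℤ.+ i ℚ./ 1)) (ℚ.toℚᵘ-fromℚᵘ (ℚᵘ.mkℚᵘ (ℤ.+ j) 0)) ⟩
    ℚ.toℚᵘ (ℤ.+ 1 ℚ./ 84) ℚᵘ.* ℚ.toℚᵘ (ℤ.+ i ℚ./ 1) ℚᵘ.* ℚᵘ.mkℚᵘ (ℤ.+ j) 0
      -- `mkℚᵘ` stores the denominator minus one, so 83 and 0 stand for 84 and 1.
      ≃⟨ ℚᵘ.*-cong (ℚᵘ.*-cong (ℚ.toℚᵘ-fromℚᵘ (ℚᵘ.mkℚᵘ (ℤ.+ 1) 83))
                           (ℚ.toℚᵘ-fromℚᵘ (ℚᵘ.mkℚᵘ (ℤ.+ i) 0))) ℚᵘ.≃-refl ⟩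
    ℚᵘ.mkℚᵘ (ℤ.+ 1) 83 ℚᵘ.* ℚᵘ.mkℚᵘ (ℤ.+ i) 0 ℚᵘ.* ℚᵘ.mkℚᵘ (ℤ.+ j) 0
      ≤⟨ ℚᵘ.*≤* ineq ⟩
    ℚᵘ.mkℚᵘ (ℤ.+ l) 0
      ≃⟨ ℚ.toℚᵘ-fromℚᵘ (ℚᵘ.mkℚᵘ (ℤ.+ l) 0) ⟨
    ℚ.toℚᵘ (ℤ.+ l ℚ./ 1) ∎)
    where
    open ℚᵘ.≤-Reasoning
    ineq : ℤ.+ 1 ℤ.* ℤ.+ i ℤ.* ℤ.+ j ℤ.* ℤ.+ 1 ℤ.≤ ℤ.+ l ℤ.* ℤ.+ 84
    ineq = subst₂ ℤ._≤_
      (trans (ℤ.pos-* i j) (sym (trans (ℤ.*-identityʳ _) (cong (ℤ._* ℤ.+ j) (ℤ.*-identityˡ (ℤ.+ i))))))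
      (trans (cong ℤ.+_ (*-comm 84 l)) (ℤ.pos-* l 84)) (ℤ.+≤+ ij≤84l)

open import Data.Integer.Base using (+_)
open import Data.Rational.Base using (ℚ; 0ℚ; _/_; _*_; _≤_; _<_)

theorem12 : ∃[ κ ] (0ℚ < κ × (∃[ n₀ ] (∀ (n : ℕ) → n ≥ n₀ →
    ∃[ σ ] ∃[ X ] (length {A = Fin σ} X ≡ n ×
    κ * (+ ⌈log₂ n ⌉ / 1) * (+ z X / 1) ≤ + z (reverse X) / 1))))
-- The threshold 64 guarantees `⌈log₂ n ⌉` at least 6. Rounding the logarithm up only strengthens
-- the bound.
theorem12 = + 1 / 84 , ℚ.positive⁻¹ (+ 1 / 84) , 64 , λ n 64≤n →
  let σ , X , eq , le = Ratio.ratio n 64≤n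
  in σ , X , eq , Ratio.scale ⌈log₂ n ⌉ (z X) (z (reverse X)) le
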